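{- Let $G$ be a partial cube of VC-dimension at most $2$. If $H=SK_n$ with $n\ge 4$ is a convex subgraph of $G$ and $H$ is not included in a larger full subdivision of $G$, then $H$ is a gated subgraph of $G$.
   Context: All graphs are finite, connected and simple. An induced subgraph $H$ of $G$ is isometric if distances in $H$ equal those in $G$. A partial cube is a graph isometrically embeddable in a hypercube $Q_m$ (vertices: subsets of $\{1,\dots,m\}$, adjacent iff their symmetric difference has size 1); it is identified with its image, hence with a set family. Its VC-dimension is the maximum size of a set $X$ with $\{X\cap S: S\in V(G)\}=2^X$. $SK_n$ is the graph obtained from the complete graph $K_n$ by subdividing each edge once; a full subdivision of $G$ is an isometric subgraph of $G$ isomorphic to some $SK_r$. An induced subgraph is convex if it contains all shortest paths of $G$ between its vertices. An induced subgraph $H$ is gated if for every vertex $x$ outside $H$ there is a vertex $x'$ of $H$ such that each vertex $y$ of $H$ is joined to $x$ by a shortest path of $G$ passing through $x'$. -}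

module Defs where

open import Data.Bool.Base using (_xor_)
open import Data.Bool.Properties using (xor-comm; xor-same)
open import Data.Fin.Base using (Fin; _<_)
open import Data.Fin.Subset using (Subset; ∣_∣; _∈_; _∉_; _⊆_; _⊂_; _∩_)
open import Data.Nat.Base using (ℕ; suc; _≤_)
open import Data.Product.Base using (Σ-syntax; ∃; ∃-syntax; _×_; _,_; proj₁)
open import Data.Vec.Base using ([]; _∷_; zipWith)
open import Data.Vec.Properties using (zipWith-comm)
open import Function.Bundles using (_⇔_; _↔_; module Inverse)
open import Level using (0ℓ)
open import Relation.Binary.Construct.Closure.Symmetric using (SymClosure; symmetric; fwd; bwd)
open import Relation.Binary.Core using (Rel)
open import Relation.Binary.Definitions using (Symmetric; Irreflexive)
open import Relation.Binary.PropositionalEquality.Core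
  using (_≡_; refl; sym; trans; cong)
open import Relation.Nullary.Negation.Core using (¬_)
open import Relation.Unary using (Pred)

record Graph (V : Set) : Set₁ where
  field
    _~_      : Rel V 0ℓ
    ~-sym    : Symmetric _~_
    ~-irrefl : Irreflexive _≡_ _~_

module _ {V : Set} (G : Graph V) where
  open Graph G

  data Walk : V → V → ℕ → Set where
    []  : ∀ {u} → Walk u u 0
    _∷_ : ∀ {u v w k} → u ~ v → Walk v w k → Walk u w (suc k)

  Connected : Set
  Connected = ∀ u v → ∃[ k ] Walk u v k

  Distance : V → V → ℕ → Set
  Distance u v d = Walk u v d × (∀ {k} → Walk u v k → d ≤ k)

module _ {V : Set} {G : Graph V} where
  open Graph G

  data OnWalk (x : V) : ∀ {u v k} → Walk G u v k → Set where
    here  : ∀ {v k} {w : Walk G x v k} → OnWalk x w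
    there : ∀ {u v t k} {e : u ~ v} {w : Walk G v t k} → OnWalk x w → OnWalk x (e ∷ w)

  -- A walk of minimum length repeats no vertex, so this is a shortest path.
  Shortest : ∀ {u v k} → Walk G u v k → Set
  Shortest {u} {v} {k} _ = ∀ {l} → Walk G u v l → k ≤ l

-- Equality of distances, including that one is defined when the other is.
Isometric : {V W : Set} → Graph V → Graph W → (V → W) → Set
Isometric G H f = ∀ u v d → Distance G u v d ⇔ Distance H (f u) (f v) d

record _≅_ {V W : Set} (G : Graph V) (H : Graph W) : Set where
  open Graph G renaming (_~_ to _~ᴳ_)
  open Graph H renaming (_~_ to _~ᴴ_)
  field
    bijection : V ↔ W
  open Inverse bijection public using (to; from)
  field
    adjacency : ∀ u v → u ~ᴳ v ⇔ to u ~ᴴ to v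

module _ {N : ℕ} (G : Graph (Fin N)) where
  open Graph G

  Induced : (S : Subset N) → Graph (∃[ v ] v ∈ S)
  Induced S = record
    { _~_      = λ u v → proj₁ u ~ proj₁ v
    ; ~-sym    = ~-sym
    ; ~-irrefl = λ u≡v → ~-irrefl (cong proj₁ u≡v)
    }

  IsometricSubgraph : Subset N → Set
  IsometricSubgraph S = Isometric (Induced S) G proj₁

  Convex : Subset N → Set
  Convex S = ∀ {u v k} → u ∈ S → v ∈ S → (w : Walk G u v k) → Shortest w →
             ∀ {x} → OnWalk x w → x ∈ S

  Gated : Subset N → Set
  Gated S = ∀ x → x ∉ S →
    ∃[ x′ ] x′ ∈ S ×
      (∀ y → y ∈ S → ∃[ k ] Σ[ w ∈ Walk G x y k ] Shortest w × OnWalk x′ w)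

-- The midpoint of the edge {i, j} of Kₙ is indexed by its endpoints in
-- increasing order, so that each edge is subdivided exactly once.
data SKVertex (n : ℕ) : Set where
  original : Fin n → SKVertex n
  midpoint : (i j : Fin n) → .(i < j) → SKVertex n

data Incident {n : ℕ} : Rel (SKVertex n) 0ℓ where
  lower : ∀ {i j} .(i<j : i < j) → Incident (original i) (midpoint i j i<j)
  upper : ∀ {i j} .(i<j : i < j) → Incident (original j) (midpoint i j i<j)

SK : (n : ℕ) → Graph (SKVertex n)
SK n = record
  { _~_      = SymClosure Incident
  ; ~-sym    = symmetric Incident
  ; ~-irrefl = λ { refl (fwd ()) ; refl (bwd ()) }
  }

FullSubdivision : ∀ {N} → Graph (Fin N) → Subset N → Set
FullSubdivision G S = IsometricSubgraph G S × ∃[ r ] (Induced G S ≅ SK r)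

InLargerFullSubdivision : ∀ {N} → Graph (Fin N) → Subset N → Set
InLargerFullSubdivision G S = ∃[ T ] S ⊂ T × FullSubdivision G T

infixl 6 _△_
_△_ : ∀ {m} → Subset m → Subset m → Subset m
_△_ = zipWith _xor_

△-comm : ∀ {m} (S T : Subset m) → S △ T ≡ T △ S
△-comm = zipWith-comm xor-comm

∣S△S∣≡0 : ∀ {m} (S : Subset m) → ∣ S △ S ∣ ≡ 0
∣S△S∣≡0 []      = refl
∣S△S∣≡0 (b ∷ S) rewrite xor-same b = ∣S△S∣≡0 S

Hypercube : (m : ℕ) → Graph (Subset m)
Hypercube m = record
  { _~_      = λ S T → ∣ S △ T ∣ ≡ 1
  ; ~-sym    = λ {S} {T} → trans (cong ∣_∣ (△-comm T S))
  ; ~-irrefl = λ { {S} refl p → 0≢1 (trans (sym (∣S△S∣≡0 S)) p) }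
  }
  where
  0≢1 : ¬ (0 ≡ 1)
  0≢1 ()

SetFamily : ℕ → Set₁
SetFamily m = Pred (Subset m) 0ℓ

Shatters : ∀ {m} → SetFamily m → Subset m → Set
Shatters F X = ∀ Y → Y ⊆ X ⇔ (∃[ S ] F S × X ∩ S ≡ Y)

VCDimension : ∀ {m} → SetFamily m → ℕ → Set
VCDimension F d =
  (∃[ X ] Shatters F X × ∣ X ∣ ≡ d) × (∀ X → Shatters F X → ∣ X ∣ ≤ d)

record PartialCube {V : Set} (G : Graph V) : Set where
  field
    dimension : ℕ
    embed     : V → Subset dimension
    isometric : Isometric G (Hypercube dimension) embed

  family : SetFamily dimension
  family S = ∃[ v ] embed v ≡ S

{-# OPTIONS --safe #-}
module Submission where

-- Translating the embedding, H becomes the family of all {eᵢ} and {eᵢ, eⱼ} for n distinct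
-- coordinates eᵢ. A vertex x has a gate in H as soon as its trace x ∩ {e₁, …, eₙ} has one
-- or two elements, the gate being the trace itself. A trace containing three elements
-- completes a shattered 3-set. Suppose that some trace is empty and choose such an x
-- inclusion-minimal; x ≠ ∅, since H is convex. Minimality makes every x + eᵢ a vertex, and
-- then VC-dimension 2 forbids vertices containing eᵢ, eⱼ and an element of x. If x = {f},
-- adding x and all {f, eᵢ} to H gives a larger full subdivision. Otherwise the geodesics
-- between x + eᵢ and {eᵢ} begin with some x + eᵢ − a and end with some {eᵢ, b}; cutting
-- geodesics where they exchange eⱼ for eᵢ shows that a and b do not depend on i, and then
-- a geodesic from {eᵢ, a} to {eⱼ, a} passes through {a}, against minimality.

open import Defs
open import Data.Bool.Base using (Bool; true; false; not; _∧_; _xor_)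
open import Data.Bool.Properties as Bool
  using (xor-assoc; xor-comm; xor-same; xor-identityʳ; not-¬; ¬-not; true-xor)
open import Data.Empty using (⊥)
open import Data.Fin.Base using (Fin; zero; suc; punchIn; punchOut)
import Data.Fin.Base as Fin
open import Data.Fin.Properties
  using (_≟_; any?; <-cmp; <⇒≢; <-asym; punchInᵢ≢i; punchIn-injective;
         punchOut-injective; punchIn-punchOut)
import Data.Fin.Properties as Finₚ
open import Data.Fin.Subset using (Subset; ∣_∣; _∈_; _∉_; _⊆_; _⊂_; _∩_; _∪_; ⁅_⁆)
import Data.Fin.Subset as Subset
open import Data.Fin.Subset.Induction using (Acc; acc; ⊂-wellFounded)
open import Data.Fin.Subset.Properties
  using (x∈⁅x⁆; x≢y⇒x∉⁅y⁆; x∈p∪q⁺; p∩q⊆p; x∈p∧x≢y⇒x∈p-y; x∈p⇒∣p-x∣<∣p∣; ∣⁅x⁆∣≡1; x∈⁅y⁆⇒x≡y; x∈p∪q⁻)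
open import Data.Nat.Base using (ℕ; zero; suc; _+_; _≤_; z≤n; s≤s; s<s; s<s⁻¹)
open import Data.Nat.Properties
  using (+-suc; ≤-trans; ≤-antisym; ≤-reflexive; <⇒≱; n≮n; suc-injective; n≤1+n)
open import Data.Product.Base using (Σ-syntax; ∃-syntax; _×_; _,_; proj₁; proj₂)
open import Data.Sum.Base using (_⊎_; inj₁; inj₂)
open import Data.Vec.Base using ([]; _∷_; lookup; tabulate)
open import Data.Vec.Properties
  using (lookup-zipWith; tabulate∘lookup; tabulate-cong; lookup∘tabulate; zipWith-assoc; zipWith-identityʳ;
         []=⇒lookup; lookup⇒[]=; ≡-dec; lookup-replicate)
open import Data.Vec.Properties.WithK using ([]=-irrelevant)
open import Function.Base using (_∘_)
open import Function.Bundles using (mk⇔; mk↔ₛ′; module Equivalence; module Inverse)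
open import Relation.Binary.Construct.Closure.Symmetric using (SymClosure; fwd; bwd; fold)
open import Relation.Binary.Definitions using (tri<; tri≈; tri>)
open import Relation.Binary.PropositionalEquality.Core
  using (_≡_; _≢_; refl; sym; trans; cong; cong₂; subst; subst₂; ≢-sym)
open import Relation.Binary.PropositionalEquality.Properties using (module ≡-Reasoning)
open import Relation.Nullary.Decidable
  using (Dec; yes; no; does; dec-true; _×-dec_; ¬?; recompute)
open import Relation.Nullary.Negation.Core using (¬_; contradiction)

private variable
  m : ℕ

-- Subsets as bit vectors and their symmetric differences.

lookup-ext : {S T : Subset m} → (∀ a → lookup S a ≡ lookup T a) → S ≡ T
lookup-ext {S = S} {T} eq =
  trans (sym (tabulate∘lookup S)) (trans (tabulate-cong eq) (tabulate∘lookup T))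

∉⇒lookup : {a : Fin m} {S : Subset m} → a ∉ S → lookup S a ≡ false
∉⇒lookup {a = a} {S} a∉S with lookup S a in eq
... | true  = contradiction (lookup⇒[]= a S eq) a∉S
... | false = refl

lookup⇒∉ : {a : Fin m} {S : Subset m} → lookup S a ≡ false → a ∉ S
lookup⇒∉ eq a∈S with trans (sym eq) ([]=⇒lookup a∈S)
... | ()

lookup-△ : ∀ (S T : Subset m) a → lookup (S △ T) a ≡ lookup S a xor lookup T a
lookup-△ S T a = lookup-zipWith _xor_ a S T

lookup-⁅⁆ : ∀ (a : Fin m) → lookup ⁅ a ⁆ a ≡ true
lookup-⁅⁆ a = []=⇒lookup (x∈⁅x⁆ a)

lookup-⁅⁆-≢ : ∀ {a b : Fin m} → b ≢ a → lookup ⁅ a ⁆ b ≡ false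
lookup-⁅⁆-≢ b≢a = ∉⇒lookup (x≢y⇒x∉⁅y⁆ b≢a)

flip-same : ∀ (S : Subset m) a → lookup (S △ ⁅ a ⁆) a ≡ not (lookup S a)
flip-same S a rewrite lookup-△ S ⁅ a ⁆ a | lookup-⁅⁆ a = trans (xor-comm (lookup S a) true) (true-xor _)

flip-other : ∀ (S : Subset m) {a b} → b ≢ a → lookup (S △ ⁅ a ⁆) b ≡ lookup S b
flip-other S {a} {b} b≢a rewrite lookup-△ S ⁅ a ⁆ b | lookup-⁅⁆-≢ b≢a = xor-identityʳ _

xor-cancelʳ : ∀ z x y → x xor z ≡ y xor z → x ≡ y
xor-cancelʳ z true  true  eq = refl
xor-cancelʳ z false false eq = refl
xor-cancelʳ z true  false eq = contradiction (sym eq) (not-¬ refl)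
xor-cancelʳ z false true  eq = contradiction eq (not-¬ refl)

△-assoc : ∀ (S T U : Subset m) → S △ T △ U ≡ S △ (T △ U)
△-assoc = zipWith-assoc xor-assoc

△-swap : ∀ (S T U : Subset m) → S △ T △ U ≡ S △ U △ T
△-swap S T U = trans (△-assoc S T U) (trans (cong (S △_) (△-comm T U)) (sym (△-assoc S U T)))

△-identityʳ : ∀ (S : Subset m) → S △ Subset.⊥ ≡ S
△-identityʳ = zipWith-identityʳ xor-identityʳ

△-cancel : ∀ (S T : Subset m) → S △ T △ T ≡ S
△-cancel S T = lookup-ext λ a → begin
  lookup (S △ T △ T) a                        ≡⟨ cong (λ X → lookup X a) (△-assoc S T T) ⟩
  lookup (S △ (T △ T)) a                      ≡⟨ lookup-△ S (T △ T) a ⟩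
  lookup S a xor lookup (T △ T) a             ≡⟨ cong (lookup S a xor_) (lookup-△ T T a) ⟩
  lookup S a xor (lookup T a xor lookup T a)  ≡⟨ cong (lookup S a xor_) (xor-same (lookup T a)) ⟩
  lookup S a xor false                        ≡⟨ xor-identityʳ _ ⟩
  lookup S a                                  ∎
  where open ≡-Reasoning

△-translate : ∀ (S T U : Subset m) → (S △ U) △ (T △ U) ≡ S △ T
△-translate S T U = begin
  S △ U △ (T △ U)  ≡⟨ cong (S △ U △_) (△-comm T U) ⟩
  S △ U △ (U △ T)  ≡⟨ △-assoc (S △ U) U T ⟨
  S △ U △ U △ T    ≡⟨ cong (_△ T) (△-cancel S U) ⟩
  S △ T            ∎
  where open ≡-Reasoning

∣△∣≡0⇒≡ : ∀ (S T : Subset m) → ∣ S △ T ∣ ≡ 0 → S ≡ T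
∣△∣≡0⇒≡ []          []          eq = refl
∣△∣≡0⇒≡ (true ∷ S)  (true ∷ T)  eq = cong (true ∷_) (∣△∣≡0⇒≡ S T eq)
∣△∣≡0⇒≡ (false ∷ S) (false ∷ T) eq = cong (false ∷_) (∣△∣≡0⇒≡ S T eq)

same-tail : ∀ (S T : Subset m) → suc ∣ S △ T ∣ ≡ 1 → T ≡ S △ Subset.⊥
same-tail S T eq = trans (sym (∣△∣≡0⇒≡ S T (suc-injective eq))) (sym (△-identityʳ S))

∣△∣≡1⇒flip : ∀ (S T : Subset m) → ∣ S △ T ∣ ≡ 1 → ∃[ a ] T ≡ S △ ⁅ a ⁆
∣△∣≡1⇒flip []          []          ()
∣△∣≡1⇒flip (false ∷ S) (false ∷ T) eq with ∣△∣≡1⇒flip S T eq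
... | a , T≡ = suc a , cong (false ∷_) T≡
∣△∣≡1⇒flip (true ∷ S)  (true ∷ T)  eq with ∣△∣≡1⇒flip S T eq
... | a , T≡ = suc a , cong (true ∷_) T≡
∣△∣≡1⇒flip (true ∷ S)  (false ∷ T) eq = zero , cong (false ∷_) (same-tail S T eq)
∣△∣≡1⇒flip (false ∷ S) (true ∷ T)  eq = zero , cong (true ∷_) (same-tail S T eq)

∣flip∣ : ∀ (S : Subset m) a → ∣ S △ (S △ ⁅ a ⁆) ∣ ≡ 1
∣flip∣ S a = trans (cong ∣_∣ eq) (∣⁅x⁆∣≡1 a)
  where
  eq : S △ (S △ ⁅ a ⁆) ≡ ⁅ a ⁆
  eq = trans (△-comm S (S △ ⁅ a ⁆)) (trans (cong (_△ S) (△-comm S ⁅ a ⁆)) (△-cancel ⁅ a ⁆ S))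

-- Intervals, distances and walks in the hypercube.

Between : Subset m → Subset m → Subset m → Set
Between S U T = ∀ a → lookup U a ≡ lookup S a ⊎ lookup U a ≡ lookup T a

-- `Between` describes the interval from `S` to `T` coordinatewise: a coordinate that must change
-- does so on exactly one side of `U`, and no other coordinate changes, so Hamming distances add up.
between-∣△∣ : ∀ (S U T : Subset m) → Between S U T → ∣ S △ U ∣ + ∣ U △ T ∣ ≡ ∣ S △ T ∣
between-∣△∣ []      []      []      _   = refl
between-∣△∣ (s ∷ S) (u ∷ U) (t ∷ T) btw with between-∣△∣ S U T (btw ∘ suc) | btw zero
between-∣△∣ (false ∷ S) (false ∷ U) (false ∷ T) btw | ih | _ = ih
between-∣△∣ (true  ∷ S) (true  ∷ U) (true  ∷ T) btw | ih | _ = ih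
between-∣△∣ (false ∷ S) (false ∷ U) (true  ∷ T) btw | ih | _ = trans (+-suc _ _) (cong suc ih)
between-∣△∣ (true  ∷ S) (true  ∷ U) (false ∷ T) btw | ih | _ = trans (+-suc _ _) (cong suc ih)
between-∣△∣ (false ∷ S) (true  ∷ U) (true  ∷ T) btw | ih | _ = cong suc ih
between-∣△∣ (true  ∷ S) (false ∷ U) (false ∷ T) btw | ih | _ = cong suc ih
between-∣△∣ (false ∷ S) (true  ∷ U) (false ∷ T) btw | ih | inj₁ ()
between-∣△∣ (false ∷ S) (true  ∷ U) (false ∷ T) btw | ih | inj₂ ()
between-∣△∣ (true  ∷ S) (false ∷ U) (true  ∷ T) btw | ih | inj₁ ()
between-∣△∣ (true  ∷ S) (false ∷ U) (true  ∷ T) btw | ih | inj₂ ()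

-- The flipped set agrees with `T` at `a` and with `S` elsewhere, hence lies in the interval, one
-- unit away from `S`.
flip-closer : ∀ (S T : Subset m) a → lookup S a ≢ lookup T a →
              ∣ S △ T ∣ ≡ suc ∣ S △ ⁅ a ⁆ △ T ∣
flip-closer S T a S≢T =
  trans (sym (between-∣△∣ S (S △ ⁅ a ⁆) T btw)) (cong (_+ ∣ S △ ⁅ a ⁆ △ T ∣) (∣flip∣ S a))
  where
  btw : Between S (S △ ⁅ a ⁆) T
  btw b with b ≟ a
  ... | yes refl = inj₂ (trans (flip-same S b) (sym (¬-not (S≢T ∘ sym))))
  ... | no b≢a   = inj₁ (flip-other S b≢a)

-- This is `flip-closer` read from the flipped set, which differs from `T` at `a` and returns to `S`
-- under a second flip.
flip-farther : ∀ (S T : Subset m) a → lookup S a ≡ lookup T a →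
               ∣ S △ ⁅ a ⁆ △ T ∣ ≡ suc ∣ S △ T ∣
flip-farther S T a S≡T =
  trans (flip-closer (S △ ⁅ a ⁆) T a
           λ eq → not-¬ (sym S≡T) (trans (sym eq) (flip-same S a)))
        (cong (λ X → suc ∣ X △ T ∣) (△-cancel S ⁅ a ⁆))

walk-hypercube : ∀ (S T : Subset m) → Walk (Hypercube m) S T ∣ S △ T ∣
walk-hypercube []      []      = []
walk-hypercube {suc m} (b ∷ S) (b′ ∷ T) = first b b′
  where
  prepend : ∀ c {S T k} → Walk (Hypercube m) S T k → Walk (Hypercube (suc m)) (c ∷ S) (c ∷ T) k
  prepend c     []      = []
  prepend true  (e ∷ w) = e ∷ prepend true w
  prepend false (e ∷ w) = e ∷ prepend false w

  first : ∀ b b′ → Walk (Hypercube (suc m)) (b ∷ S) (b′ ∷ T) ∣ (b ∷ S) △ (b′ ∷ T) ∣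
  first true  true  = prepend true (walk-hypercube S T)
  first false false = prepend false (walk-hypercube S T)
  first true  false = cong suc (∣S△S∣≡0 S) ∷ prepend false (walk-hypercube S T)
  first false true  = cong suc (∣S△S∣≡0 S) ∷ prepend true (walk-hypercube S T)

-- An edge flips a single coordinate and so lowers the distance to `T` by at most one.
∣△∣≤walk : ∀ {S T : Subset m} {k} → Walk (Hypercube m) S T k → ∣ S △ T ∣ ≤ k
∣△∣≤walk {S = S} [] = ≤-reflexive (∣S△S∣≡0 S)
∣△∣≤walk {S = S} {T} (_∷_ {v = U} e w) with ∣△∣≡1⇒flip S U e
... | a , refl with lookup S a Bool.≟ lookup T a
...   | no S≢T  = ≤-trans (≤-reflexive (flip-closer S T a S≢T)) (s≤s (∣△∣≤walk w))
...   | yes S≡T = ≤-trans (n≤1+n _) (≤-trans (≤-reflexive (sym (flip-farther S T a S≡T)))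
                    (≤-trans (∣△∣≤walk w) (n≤1+n _)))

distance-hypercube : ∀ (S T : Subset m) → Distance (Hypercube m) S T ∣ S △ T ∣
distance-hypercube S T = walk-hypercube S T , ∣△∣≤walk

-- Walks and distances in arbitrary graphs.

walk-zero : ∀ {V : Set} {G : Graph V} {u v} → Walk G u v 0 → u ≡ v
walk-zero [] = refl

walk-one : ∀ {V : Set} {G : Graph V} {u v} → Walk G u v 1 → Graph._~_ G u v
walk-one (e ∷ []) = e

walk-map : ∀ {V W : Set} {G : Graph V} {K : Graph W} (f : V → W) →
           (∀ {u v} → Graph._~_ G u v → Graph._~_ K (f u) (f v)) →
           ∀ {u v k} → Walk G u v k → Walk K (f u) (f v) k
walk-map f f-adj []      = []
walk-map f f-adj (e ∷ w) = f-adj e ∷ walk-map f f-adj w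

module _ {V : Set} {G : Graph V} where

  infixr 5 _++_
  _++_ : ∀ {u v w k l} → Walk G u v k → Walk G v w l → Walk G u w (k + l)
  []      ++ q = q
  (e ∷ p) ++ q = e ∷ (p ++ q)

  end-of-first : ∀ {u v w k l} (p : Walk G u v k) (q : Walk G v w l) → OnWalk v (p ++ q)
  end-of-first []      q = here
  end-of-first (e ∷ p) q = there (end-of-first p q)

  distance-unique : ∀ {u v k l} → Distance G u v k → Distance G u v l → k ≡ l
  distance-unique (w , w-min) (w′ , w′-min) = ≤-antisym (w-min w′) (w′-min w)

-- Midpoints indexed by unordered pairs.

edge : ∀ {r} → Fin r → Fin r → SKVertex r
edge i j with <-cmp i j
... | tri< i<j _ _ = midpoint i j i<j
-- A default value: the diagonal carries no edge of the complete graph.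
... | tri≈ _ _ _   = original i
... | tri> _ _ j<i = midpoint j i j<i

edge-< : ∀ {r} {i j : Fin r} .(i<j : i Fin.< j) → edge i j ≡ midpoint i j i<j
edge-< {i = i} {j} i<j with <-cmp i j
... | tri< _ _ _   = refl
... | tri≈ i≮j _ _ = contradiction (recompute (i Finₚ.<? j) i<j) i≮j
... | tri> i≮j _ _ = contradiction (recompute (i Finₚ.<? j) i<j) i≮j

edge-> : ∀ {r} {i j : Fin r} .(j<i : j Fin.< i) → edge i j ≡ midpoint j i j<i
edge-> {i = i} {j} j<i with <-cmp i j
... | tri< _ _ j≮i = contradiction (recompute (j Finₚ.<? i) j<i) j≮i
... | tri≈ _ _ j≮i = contradiction (recompute (j Finₚ.<? i) j<i) j≮i
... | tri> _ _ _   = refl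

edge-comm : ∀ {r} {i j : Fin r} → i ≢ j → edge i j ≡ edge j i
edge-comm {i = i} {j} i≢j with <-cmp i j
... | tri< i<j _ _ = sym (edge-> i<j)
... | tri≈ _ i≡j _ = contradiction i≡j i≢j
... | tri> _ _ j<i = sym (edge-< j<i)

edge-incident : ∀ {r} {i j : Fin r} → i ≢ j → SymClosure Incident (original i) (edge i j)
edge-incident {i = i} {j} i≢j with <-cmp i j
... | tri< i<j _ _ = fwd (lower i<j)
... | tri≈ _ i≡j _ = contradiction i≡j i≢j
... | tri> _ _ j<i = fwd (upper j<i)

edge-not-incident : ∀ {r} {i j k : Fin r} → k ≢ i → k ≢ j →
                    ¬ SymClosure Incident (original k) (edge i j)
edge-not-incident {i = i} {j} k≢i k≢j inc with <-cmp i j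
edge-not-incident k≢i k≢j (fwd (lower _)) | tri< _ _ _ = k≢i refl
edge-not-incident k≢i k≢j (fwd (upper _)) | tri< _ _ _ = k≢j refl
edge-not-incident k≢i k≢j (fwd (lower _)) | tri> _ _ _ = k≢j refl
edge-not-incident k≢i k≢j (fwd (upper _)) | tri> _ _ _ = k≢i refl
edge-not-incident k≢i k≢j (fwd ())        | tri≈ _ _ _
edge-not-incident k≢i k≢j (bwd ())        | tri≈ _ _ _
edge-not-incident k≢i k≢j (bwd ())        | tri< _ _ _
edge-not-incident k≢i k≢j (bwd ())        | tri> _ _ _

-- The standard copy of the subdivided complete graph in the hypercube.

pair-left : ∀ {a b : Fin m} → a ≢ b → lookup (⁅ a ⁆ △ ⁅ b ⁆) a ≡ true
pair-left {a = a} {b} a≢b = trans (flip-other ⁅ a ⁆ a≢b) (lookup-⁅⁆ a)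

pair-right : ∀ {a b : Fin m} → a ≢ b → lookup (⁅ a ⁆ △ ⁅ b ⁆) b ≡ true
pair-right {a = a} {b} a≢b = trans (flip-same ⁅ a ⁆ b) (cong not (lookup-⁅⁆-≢ (≢-sym a≢b)))

pair-other : ∀ {a b x : Fin m} → x ≢ a → x ≢ b → lookup (⁅ a ⁆ △ ⁅ b ⁆) x ≡ false
pair-other {a = a} x≢a x≢b = trans (flip-other ⁅ a ⁆ x≢b) (lookup-⁅⁆-≢ x≢a)

∈⁅⁆ : ∀ {a x : Fin m} → lookup ⁅ a ⁆ x ≡ true → x ≡ a
∈⁅⁆ {a = a} {x} eq = x∈⁅y⁆⇒x≡y a (lookup⇒[]= x _ eq)

∈pair : ∀ {a b x : Fin m} → lookup (⁅ a ⁆ △ ⁅ b ⁆) x ≡ true → x ≡ a ⊎ x ≡ b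
∈pair {a = a} {b} {x} eq with x ≟ a | x ≟ b
... | yes x≡a | _       = inj₁ x≡a
... | no _    | yes x≡b = inj₂ x≡b
... | no x≢a  | no x≢b  = contradiction (trans (sym eq) (pair-other x≢a x≢b)) λ ()

module StandardSK {r m : ℕ} (e : Fin r → Fin m) (e-injective : ∀ {i j} → e i ≡ e j → i ≡ j) where

  -- The standard copy of `SK r`, centred at the empty set, which is not itself in the copy. What
  -- follows shows that it is isometric.
  ψ : SKVertex r → Subset m
  ψ (original i)     = ⁅ e i ⁆
  ψ (midpoint i j _) = ⁅ e i ⁆ △ ⁅ e j ⁆

  ψ-edge : ∀ {i j} → i ≢ j → ψ (edge i j) ≡ ⁅ e i ⁆ △ ⁅ e j ⁆
  ψ-edge {i} {j} i≢j with <-cmp i j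
  ... | tri< _ _ _   = refl
  ... | tri≈ _ i≡j _ = contradiction i≡j i≢j
  ... | tri> _ _ _   = △-comm ⁅ e j ⁆ ⁅ e i ⁆

  e-≢ : ∀ {i j} → i ≢ j → e i ≢ e j
  e-≢ i≢j = i≢j ∘ e-injective

  midpoint-≢ : ∀ {i j : Fin r} → .(i Fin.< j) → i ≢ j
  midpoint-≢ {i} {j} i<j = <⇒≢ (recompute (i Finₚ.<? j) i<j)

  Closer : SKVertex r → SKVertex r → Set
  Closer s t = ∃[ s′ ] SymClosure Incident s s′ × ∣ ψ s △ ψ t ∣ ≡ suc ∣ ψ s′ △ ψ t ∣

  closer : ∀ {s s′ a} t → SymClosure Incident s s′ → ψ s′ ≡ ψ s △ ⁅ a ⁆ →
           lookup (ψ s) a ≢ lookup (ψ t) a → Closer s t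
  closer {s} {s′} {a} t inc s′≡ s≢t =
    s′ , inc , trans (flip-closer (ψ s) (ψ t) a s≢t) (cong (λ S → suc ∣ S △ ψ t ∣) (sym s′≡))

  grow : ∀ {i j} t → i ≢ j → lookup (ψ t) (e j) ≡ true → Closer (original i) t
  grow {i} {j} t i≢j j∈t = closer t (edge-incident i≢j) (ψ-edge i≢j)
    λ eq → contradiction (trans (sym (lookup-⁅⁆-≢ (≢-sym (e-≢ i≢j)))) (trans eq j∈t)) λ ()

  shrinkʳ : ∀ {i j} t → .(i<j : i Fin.< j) → lookup (ψ t) (e j) ≡ false → Closer (midpoint i j i<j) t
  shrinkʳ {i} {j} t i<j j∉t = closer t (bwd (lower i<j)) (sym (△-cancel ⁅ e i ⁆ ⁅ e j ⁆))
    λ eq → contradiction (trans (sym (pair-right (e-≢ (midpoint-≢ i<j)))) (trans eq j∉t)) λ ()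

  shrinkˡ : ∀ {i j} t → .(i<j : i Fin.< j) → lookup (ψ t) (e i) ≡ false → Closer (midpoint i j i<j) t
  shrinkˡ {i} {j} t i<j i∉t =
    closer t (bwd (upper i<j))
           (trans (sym (△-cancel ⁅ e j ⁆ ⁅ e i ⁆)) (cong (_△ ⁅ e i ⁆) (△-comm ⁅ e j ⁆ ⁅ e i ⁆)))
    λ eq → contradiction (trans (sym (pair-left (e-≢ (midpoint-≢ i<j)))) (trans eq i∉t)) λ ()

  ∈ψ-mid : ∀ {k l x} → lookup (⁅ e k ⁆ △ ⁅ e l ⁆) (e x) ≡ true → x ≡ k ⊎ x ≡ l
  ∈ψ-mid eq with ∈pair eq
  ... | inj₁ p = inj₁ (e-injective p)
  ... | inj₂ p = inj₂ (e-injective p)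

  -- This carries the isometry of `ψ`. A singleton other than the target can gain an element of the
  -- target, a pair can lose an element outside the target, and a pair contained in the target is
  -- the target. Each move stays in the copy and lowers the distance by one.
  SK-step : ∀ s t → s ≡ t ⊎ Closer s t
  SK-step (original i) (original j) with i ≟ j
  ... | yes refl = inj₁ refl
  ... | no i≢j   = inj₂ (grow (original j) i≢j (lookup-⁅⁆ (e j)))
  SK-step (original i) (midpoint k l k<l) with i ≟ k
  ... | no i≢k   = inj₂ (grow (midpoint k l k<l) i≢k (pair-left (e-≢ (midpoint-≢ k<l))))
  ... | yes refl = inj₂ (grow (midpoint k l k<l) (midpoint-≢ k<l) (pair-right (e-≢ (midpoint-≢ k<l))))
  SK-step (midpoint i j i<j) t
    with lookup (ψ t) (e i) in i∈t | lookup (ψ t) (e j) in j∈t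
  ... | false | _     = inj₂ (shrinkˡ t i<j i∈t)
  ... | true  | false = inj₂ (shrinkʳ t i<j j∈t)
  SK-step (midpoint i j i<j) (original k) | true | true =
    contradiction (e-injective (trans (∈⁅⁆ {a = e k} i∈t) (sym (∈⁅⁆ {a = e k} j∈t)))) (midpoint-≢ i<j)
  SK-step (midpoint i j i<j) (midpoint k l k<l) | true | true with ∈ψ-mid i∈t | ∈ψ-mid j∈t
  ... | inj₁ refl | inj₂ refl = inj₁ refl
  ... | inj₁ refl | inj₁ refl = contradiction refl (midpoint-≢ i<j)
  ... | inj₂ refl | inj₂ refl = contradiction refl (midpoint-≢ i<j)
  ... | inj₂ refl | inj₁ refl =
    contradiction (recompute (l Finₚ.<? k) i<j) (<-asym (recompute (k Finₚ.<? l) k<l))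

  -- Distinct vertices admit a step that lowers the distance of their images, so that distance is
  -- positive.
  ψ-injective : ∀ {s t} → ψ s ≡ ψ t → s ≡ t
  ψ-injective {s} {t} eq with SK-step s t
  ... | inj₁ s≡t = s≡t
  ... | inj₂ (s′ , _ , d) =
    contradiction (trans (sym d) (trans (cong (λ S → ∣ S △ ψ t ∣) eq) (∣S△S∣≡0 (ψ t)))) λ ()

  -- Iterates `SK-step`; the remaining distance is a separate argument, which makes the recursion
  -- structural.
  SK-walk : ∀ s t → Walk (SK r) s t ∣ ψ s △ ψ t ∣
  SK-walk s t = go s ∣ ψ s △ ψ t ∣ refl
    where
    go : ∀ s k → ∣ ψ s △ ψ t ∣ ≡ k → Walk (SK r) s t k
    go s k k≡ with SK-step s t
    go s k k≡ | inj₁ refl = subst (Walk (SK r) s s) (trans (sym (∣S△S∣≡0 (ψ s))) k≡) []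
    go s zero k≡ | inj₂ (s′ , inc , d) = contradiction (trans (sym d) k≡) λ ()
    go s (suc k) k≡ | inj₂ (s′ , inc , d) = inc ∷ go s′ k (suc-injective (trans (sym d) k≡))

  incident⇒∣△∣≡1 : ∀ {s t} → SymClosure Incident s t → ∣ ψ s △ ψ t ∣ ≡ 1
  incident⇒∣△∣≡1 = fold (λ {s} {t} → trans (cong ∣_∣ (△-comm (ψ t) (ψ s)))) incident
    where
    incident : ∀ {s t} → Incident s t → ∣ ψ s △ ψ t ∣ ≡ 1
    incident (lower {i} {j} _) = ∣flip∣ ⁅ e i ⁆ (e j)
    incident (upper {i} {j} _) =
      trans (cong (λ S → ∣ ⁅ e j ⁆ △ S ∣) (△-comm ⁅ e i ⁆ ⁅ e j ⁆)) (∣flip∣ ⁅ e j ⁆ (e i))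

  ∣△∣≡1⇒incident : ∀ {s t} → ∣ ψ s △ ψ t ∣ ≡ 1 → SymClosure Incident s t
  ∣△∣≡1⇒incident {s} {t} eq = walk-one (subst (Walk (SK r) s t) eq (SK-walk s t))

  ψ-used : ∀ s {a} → lookup (ψ s) a ≡ true → ∃[ i ] a ≡ e i
  ψ-used (original i) a∈ = i , ∈⁅⁆ a∈
  ψ-used (midpoint i j _) a∈ with ∈pair a∈
  ... | inj₁ eq = i , eq
  ... | inj₂ eq = j , eq

  ψ-nonempty : ∀ s → ∃[ i ] lookup (ψ s) (e i) ≡ true
  ψ-nonempty (original i)       = i , lookup-⁅⁆ (e i)
  ψ-nonempty (midpoint i j i<j) = i , pair-left (e-≢ (midpoint-≢ i<j))

-- Equality of members, decidability and fresh indices.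

∃∈-≡ : {S : Subset m} {x y : ∃[ a ] a ∈ S} → proj₁ x ≡ proj₁ y → x ≡ y
∃∈-≡ {x = a , p} {y = .a , q} refl = cong (a ,_) ([]=-irrelevant p q)

_≟ˢ_ : (S T : Subset m) → Dec (S ≡ T)
_≟ˢ_ = ≡-dec Bool._≟_

fresh₂ : ∀ {n} {i j : Fin (suc (suc (suc n)))} → i ≢ j → ∃[ h ] h ≢ i × h ≢ j
fresh₂ {i = i} i≢j = punchIn i h , punchInᵢ≢i i h , λ eq →
  punchInᵢ≢i (punchOut i≢j) zero
    (punchIn-injective i h (punchOut i≢j) (trans eq (sym (punchIn-punchOut i≢j))))
  where h = punchIn (punchOut i≢j) zero

-- Deleting `i` by `punchOut` leaves at least three indices, of which two must be avoided.
fresh₃ : ∀ {n} {i j l : Fin (suc (suc (suc (suc n))))} → i ≢ j → i ≢ l → j ≢ l →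
         ∃[ h ] h ≢ i × h ≢ j × h ≢ l
fresh₃ {i = i} i≢j i≢l j≢l
  with fresh₂ {i = punchOut i≢j} {punchOut i≢l} (j≢l ∘ punchOut-injective i≢j i≢l)
... | h , h≢j , h≢l =
  punchIn i h , punchInᵢ≢i i h , avoids i≢j h≢j , avoids i≢l h≢l
  where
  avoids : ∀ {x} (i≢x : i ≢ x) → h ≢ punchOut i≢x → punchIn i h ≢ x
  avoids i≢x h≢x eq = h≢x (punchIn-injective i h (punchOut i≢x) (trans eq (sym (punchIn-punchOut i≢x))))

-- Graphs whose distances are the Hamming distances of their labels.

module Embedded {N m : ℕ} (G : Graph (Fin N)) (φ : Fin N → Subset m)
                (distance : ∀ u v → Distance G u v ∣ φ u △ φ v ∣) where
  open Graph G

  φ-injective : ∀ {u v} → φ u ≡ φ v → u ≡ v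
  φ-injective {u} {v} eq =
    walk-zero (subst (Walk G u v) (trans (cong (λ S → ∣ S △ φ v ∣) eq) (∣S△S∣≡0 (φ v)))
                     (proj₁ (distance u v)))

  adj⇒∣△∣≡1 : ∀ {u v} → u ~ v → ∣ φ u △ φ v ∣ ≡ 1
  adj⇒∣△∣≡1 {u} {v} e with ∣ φ u △ φ v ∣ in eq | proj₂ (distance u v) (e ∷ [])
  ... | 0           | _       = contradiction e (~-irrefl (φ-injective (∣△∣≡0⇒≡ _ _ eq)))
  ... | 1           | _       = refl
  ... | suc (suc _) | s≤s ()

  ∣△∣≡1⇒adj : ∀ {u v} → ∣ φ u △ φ v ∣ ≡ 1 → u ~ v
  ∣△∣≡1⇒adj {u} {v} eq = walk-one (subst (Walk G u v) eq (proj₁ (distance u v)))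

  adj⇒flip : ∀ {u v} → u ~ v → ∃[ a ] φ v ≡ φ u △ ⁅ a ⁆
  adj⇒flip e = ∣△∣≡1⇒flip _ _ (adj⇒∣△∣≡1 e)

  flip⇒adj : ∀ {u v a} → φ v ≡ φ u △ ⁅ a ⁆ → u ~ v
  flip⇒adj {u} {v} {a} eq = ∣△∣≡1⇒adj (trans (cong (λ S → ∣ φ u △ S ∣) eq) (∣flip∣ (φ u) a))

  Step : Fin N → Fin N → Set
  Step u v = ∃[ w ] ∃[ a ] φ w ≡ φ u △ ⁅ a ⁆ × lookup (φ u) a ≢ lookup (φ v) a

  -- The first edge of a geodesic flips some `a`. If the labels of `u` and `v` agreed at `a`, the
  -- distance to `v` would grow along that edge, although the rest of the geodesic is shorter.
  step : ∀ u v → φ u ≢ φ v → Step u v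
  step u v u≢v = go refl (proj₁ (distance u v))
    where
    go : ∀ {k} → k ≡ ∣ φ u △ φ v ∣ → Walk G u v k → Step u v
    go k≡ []                    = contradiction refl u≢v
    go k≡ (_∷_ {v = w} {k = k} e p) with adj⇒flip e
    ... | a , w≡ = w , a , w≡ , λ same →
      n≮n k (≤-trans (n≤1+n _) (≤-trans (≤-reflexive (cong suc k≡)) (≤-trans
        (≤-reflexive (trans (sym (flip-farther (φ u) (φ v) a same))
                            (cong (λ S → ∣ S △ φ v ∣) (sym w≡))))
        (proj₂ (distance w v) p))))

  -- On a geodesic along which i is deleted and j is inserted, the vertex between
  -- these two moves contains both or neither of i and j.
  Cut : Fin N → Fin N → Fin m → Fin m → Set
  Cut u v i j = ∃[ w ] Between (φ u) (φ w) (φ v) ×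
    ((lookup (φ w) i ≡ true × lookup (φ w) j ≡ true) ⊎
     (lookup (φ w) i ≡ false × lookup (φ w) j ≡ false))

  cut : ∀ u v {i j} →
        lookup (φ u) i ≡ true → lookup (φ u) j ≡ false →
        lookup (φ v) i ≡ false → lookup (φ v) j ≡ true → Cut u v i j
  cut u v {i} {j} = go u ∣ φ u △ φ v ∣ refl
    where
    go : ∀ u k → ∣ φ u △ φ v ∣ ≡ k →
         lookup (φ u) i ≡ true → lookup (φ u) j ≡ false →
         lookup (φ v) i ≡ false → lookup (φ v) j ≡ true → Cut u v i j
    go u k k≡ ui uj vi vj
      with step u v (λ eq → contradiction
                              (trans (sym ui) (trans (cong (λ S → lookup S i) eq) vi)) λ ())
    ... | w , a , w≡ , u≢v = split (i ≟ a) (j ≟ a) k (trans (sym closer) k≡)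
      where
      closer : ∣ φ u △ φ v ∣ ≡ suc ∣ φ w △ φ v ∣
      closer = trans (flip-closer (φ u) (φ v) a u≢v) (cong (λ S → suc ∣ S △ φ v ∣) (sym w≡))

      same : ∀ {b} → b ≢ a → lookup (φ w) b ≡ lookup (φ u) b
      same b≢a = trans (cong (λ S → lookup S _) w≡) (flip-other (φ u) b≢a)

      flipped : lookup (φ w) a ≡ not (lookup (φ u) a)
      flipped = trans (cong (λ S → lookup S a) w≡) (flip-same (φ u) a)

      between : Between (φ u) (φ w) (φ v)
      between b with b ≟ a
      ... | yes refl = inj₂ (trans flipped (sym (¬-not (u≢v ∘ sym))))
      ... | no b≢a   = inj₁ (same b≢a)

      -- The first flip of `i` or `j` decides: deleting `i` first leaves neither, inserting `j`
      -- first leaves both. A flip of any other coordinate only shortens the way to `v`.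
      split : Dec (i ≡ a) → Dec (j ≡ a) → ∀ k → suc ∣ φ w △ φ v ∣ ≡ k → Cut u v i j
      split (yes refl) (yes refl) k _ = contradiction (trans (sym ui) uj) λ ()
      split (yes refl) (no j≢a) k _   =
        w , between , inj₂ (trans flipped (cong not ui) , trans (same j≢a) uj)
      split (no i≢a) (yes refl) k _   =
        w , between , inj₁ (trans (same i≢a) ui , trans flipped (cong not uj))
      split (no i≢a) (no j≢a) zero ()
      split (no i≢a) (no j≢a) (suc k) k≡
        with go w k (suc-injective k≡) (trans (same i≢a) ui) (trans (same j≢a) uj) vi vj
      ... | x , btw , x-ij = x , btw′ , x-ij
        where
        -- Intervals nest: `w` lies between `u` and `v`, hence so does everything between `w` and
        -- `v`.
        btw′ : Between (φ u) (φ x) (φ v)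
        btw′ b with btw b | between b
        ... | inj₂ x≡v | _        = inj₂ x≡v
        ... | inj₁ x≡w | inj₁ w≡u = inj₁ (trans x≡w w≡u)
        ... | inj₁ x≡w | inj₂ w≡v = inj₂ (trans x≡w w≡v)

  -- Full subdivisions from realised singletons and pairs.

  module Realised {r : ℕ} (e : Fin r → Fin m) (e-injective : ∀ {i j} → e i ≡ e j → i ≡ j)
                  (V : SKVertex r → Fin N)
                  (V-ψ : ∀ s → φ (V s) ≡ StandardSK.ψ e e-injective s) where
    open StandardSK e e-injective

    -- Decidability allows the vertex set of the copy to be tabulated as a `Subset N`.
    realised? : ∀ v → Dec (∃[ s ] φ v ≡ ψ s)
    realised? v
      with any? (λ i → φ v ≟ˢ ⁅ e i ⁆)
         | any? (λ i → any? (λ j → (i Finₚ.<? j) ×-dec (φ v ≟ˢ (⁅ e i ⁆ △ ⁅ e j ⁆))))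
    ... | yes (i , eq) | _                      = yes (original i , eq)
    ... | no _         | yes (i , j , i<j , eq) = yes (midpoint i j i<j , eq)
    ... | no ¬orig     | no ¬mid                = no λ
      { (original i , eq)       → ¬orig (i , eq)
      ; (midpoint i j i<j , eq) → ¬mid (i , j , recompute (i Finₚ.<? j) i<j , eq)
      }

    image : Subset N
    image = tabulate (does ∘ realised?)

    ∈image⁺ : ∀ {v s} → φ v ≡ ψ s → v ∈ image
    ∈image⁺ {v} {s} eq =
      lookup⇒[]= v image (trans (lookup∘tabulate _ v) (dec-true (realised? v) (s , eq)))

    ∈image⁻ : ∀ {v} → v ∈ image → ∃[ s ] φ v ≡ ψ s
    ∈image⁻ {v} v∈ with realised? v | trans (sym (lookup∘tabulate (does ∘ realised?) v)) ([]=⇒lookup v∈)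
    ... | yes s | _ = s
    ... | no _  | ()

    toImage : SKVertex r → ∃[ v ] v ∈ image
    toImage s = V s , ∈image⁺ {s = s} (V-ψ s)

    fromImage : ∃[ v ] v ∈ image → SKVertex r
    fromImage (v , v∈) = proj₁ (∈image⁻ v∈)

    φ-fromImage : ∀ v → φ (proj₁ v) ≡ ψ (fromImage v)
    φ-fromImage (v , v∈) = proj₂ (∈image⁻ v∈)

    fromImage∘toImage : ∀ s → fromImage (toImage s) ≡ s
    fromImage∘toImage s = ψ-injective (trans (sym (φ-fromImage (toImage s))) (V-ψ s))

    toImage∘fromImage : ∀ v → toImage (fromImage v) ≡ v
    toImage∘fromImage v = ∃∈-≡ (φ-injective (trans (V-ψ (fromImage v)) (sym (φ-fromImage v))))

    ∣φ△φ∣ : ∀ u v → ∣ φ (proj₁ u) △ φ (proj₁ v) ∣ ≡ ∣ ψ (fromImage u) △ ψ (fromImage v) ∣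
    ∣φ△φ∣ u v = cong₂ (λ S T → ∣ S △ T ∣) (φ-fromImage u) (φ-fromImage v)

    V-adj : ∀ {s t} → SymClosure Incident s t → V s ~ V t
    V-adj {s} {t} inc =
      ∣△∣≡1⇒adj (trans (cong₂ (λ S T → ∣ S △ T ∣) (V-ψ s) (V-ψ t)) (incident⇒∣△∣≡1 inc))

    image≅SK : Induced G image ≅ SK r
    image≅SK = record
      { bijection = mk↔ₛ′ fromImage toImage fromImage∘toImage toImage∘fromImage
      ; adjacency = λ u v → mk⇔
          (λ u~v → ∣△∣≡1⇒incident (trans (sym (∣φ△φ∣ u v)) (adj⇒∣△∣≡1 u~v)))
          (λ inc → ∣△∣≡1⇒adj (trans (∣φ△φ∣ u v) (incident⇒∣△∣≡1 inc)))
      }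

    -- A geodesic of the standard copy, transported by `toImage`, attains the Hamming distance
    -- inside `image`; the lower bound is inherited from `G`.
    image-distance : ∀ u v → Distance (Induced G image) u v ∣ φ (proj₁ u) △ φ (proj₁ v) ∣
    image-distance u v =
      subst₂ (λ u′ v′ → Walk (Induced G image) u′ v′ _)
             (toImage∘fromImage u) (toImage∘fromImage v)
             (subst (Walk (Induced G image) _ _) (sym (∣φ△φ∣ u v))
                    (walk-map toImage V-adj (SK-walk (fromImage u) (fromImage v)))) ,
      λ w → proj₂ (distance _ _) (walk-map proj₁ (λ u~v → u~v) w)

    image-isometric : IsometricSubgraph G image
    image-isometric u v d = mk⇔
      (λ dist → subst (Distance G _ _) (distance-unique (image-distance u v) dist) (distance _ _))
      (λ dist → subst (Distance (Induced G image) u v)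
                      (distance-unique (distance _ _) dist) (image-distance u v))

  -- Recovering the coordinates of an arbitrary induced copy of the subdivided complete graph.

  module Directions {k : ℕ} (V : SKVertex (suc (suc k)) → Fin N)
                    (V-adj : ∀ {s t} → SymClosure Incident s t → V s ~ V t)
                    (V-adj⁻ : ∀ {s t} → V s ~ V t → SymClosure Incident s t)
                    (V-injective : ∀ {s t} → V s ≡ V t → s ≡ t) where

    O : Fin (suc (suc k)) → Fin N
    O i = V (original i)

    M : Fin (suc (suc k)) → Fin (suc (suc k)) → Fin N
    M i j = V (edge i j)

    Dir : Fin (suc (suc k)) → Fin (suc (suc k)) → Fin m → Set
    Dir i j a = φ (M i j) ≡ φ (O i) △ ⁅ a ⁆

    dir : ∀ {i j} → i ≢ j → ∃[ a ] Dir i j a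
    dir i≢j = adj⇒flip (V-adj (edge-incident i≢j))

    O-≢ : ∀ {i j} → i ≢ j → φ (O i) ≢ φ (O j)
    O-≢ i≢j eq with V-injective (φ-injective eq)
    ... | refl = i≢j refl

    far : ∀ {i j k} → k ≢ i → k ≢ j → ¬ (M i j ~ O k)
    far k≢i k≢j adj = edge-not-incident k≢i k≢j (V-adj⁻ (~-sym adj))

    ends : ∀ {i j a b} → i ≢ j → Dir i j a → Dir j i b → φ (O j) ≡ φ (O i) △ ⁅ a ⁆ △ ⁅ b ⁆
    ends {i} {j} {a} {b} i≢j ij ji = begin
      φ (O j)                  ≡⟨ △-cancel (φ (O j)) ⁅ b ⁆ ⟨
      φ (O j) △ ⁅ b ⁆ △ ⁅ b ⁆  ≡⟨ cong (_△ ⁅ b ⁆) ji ⟨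
      φ (M j i) △ ⁅ b ⁆        ≡⟨ cong (λ s → φ (V s) △ ⁅ b ⁆) (edge-comm i≢j) ⟨
      φ (M i j) △ ⁅ b ⁆        ≡⟨ cong (_△ ⁅ b ⁆) ij ⟩
      φ (O i) △ ⁅ a ⁆ △ ⁅ b ⁆  ∎
      where open ≡-Reasoning

    -- Opposite edges of the induced hexagon through O i, O j, O k have the same direction:
    -- along the hexagon the coordinate a of the edge O i – M i j changes an even number of
    -- times, and a second change on any edge but the opposite one would identify two
    -- vertices or create a chord.
    parallel : ∀ {i j k a b} → i ≢ j → i ≢ k → j ≢ k → Dir i j a → Dir k j b → a ≡ b
    parallel {i} {j} {k} {a} {b} i≢j i≢k j≢k ij kj with a ≟ b
    ... | yes a≡b = a≡b
    ... | no a≢b with dir (≢-sym i≢j) | dir j≢k | dir (≢-sym i≢k) | dir i≢k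
    ...   | a′ , ji | d , jk | f , ki | g , ik = contradiction (trans (sym i-k) (trans k-j j-i)) (not-¬ refl)
      where
      a≢a′ : a ≢ a′
      a≢a′ refl = O-≢ i≢j (sym (trans (ends i≢j ij ji) (△-cancel _ ⁅ a ⁆)))

      a≢d : a ≢ d
      a≢d refl = far i≢j i≢k (flip⇒adj (begin
        φ (O i)                   ≡⟨ ends (≢-sym i≢j) ji ij ⟩
        φ (O j) △ ⁅ a′ ⁆ △ ⁅ a ⁆  ≡⟨ △-swap (φ (O j)) ⁅ a′ ⁆ ⁅ a ⁆ ⟩
        φ (O j) △ ⁅ a ⁆ △ ⁅ a′ ⁆  ≡⟨ cong (_△ ⁅ a′ ⁆) jk ⟨
        φ (M j k) △ ⁅ a′ ⁆        ∎))
        where open ≡-Reasoning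

      a≢f : a ≢ f
      a≢f refl = far (≢-sym i≢k) (≢-sym j≢k) (flip⇒adj (begin
        φ (O k)                  ≡⟨ ends i≢k ik ki ⟩
        φ (O i) △ ⁅ g ⁆ △ ⁅ a ⁆  ≡⟨ △-swap (φ (O i)) ⁅ g ⁆ ⁅ a ⁆ ⟩
        φ (O i) △ ⁅ a ⁆ △ ⁅ g ⁆  ≡⟨ cong (_△ ⁅ g ⁆) ij ⟨
        φ (M i j) △ ⁅ g ⁆        ∎))
        where open ≡-Reasoning

      a≢g : a ≢ g
      a≢g refl = far (≢-sym i≢k) (≢-sym j≢k)
        (subst (_~ O k) (trans (cong V (sym (edge-comm i≢k))) (φ-injective (trans ik (sym ij))))
               (~-sym (V-adj (edge-incident (≢-sym i≢k)))))

      two-flips : ∀ {S T : Subset m} {x y} → T ≡ S △ ⁅ x ⁆ △ ⁅ y ⁆ → a ≢ x → a ≢ y →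
                  lookup T a ≡ lookup S a
      two-flips {S} {x = x} eq a≢x a≢y =
        trans (cong (λ X → lookup X a) eq) (trans (flip-other (S △ ⁅ x ⁆) a≢y) (flip-other S a≢x))

      j-i : lookup (φ (O j)) a ≡ not (lookup (φ (O i)) a)
      j-i = trans (cong (λ S → lookup S a) (ends i≢j ij ji))
                  (trans (flip-other (φ (O i) △ ⁅ a ⁆) a≢a′) (flip-same (φ (O i)) a))

      k-j : lookup (φ (O k)) a ≡ lookup (φ (O j)) a
      k-j = two-flips (ends j≢k jk kj) a≢d a≢b

      i-k : lookup (φ (O k)) a ≡ lookup (φ (O i)) a
      i-k = two-flips (ends i≢k ik ki) a≢g a≢f

    -- By `parallel`, the coordinate flipped from `O i` to `M i j` depends on `j` alone; it is read
    -- off at one chosen index different from `j`.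
    e : Fin (suc (suc k)) → Fin m
    e j = proj₁ (dir (punchInᵢ≢i j zero))

    e-dir : ∀ {i j} → i ≢ j → Dir i j (e j)
    e-dir {i} {j} i≢j with i ≟ punchIn j zero
    ... | yes refl = proj₂ (dir (punchInᵢ≢i j zero))
    ... | no i≢k with dir i≢j
    ...   | a , ij = subst (Dir i j)
      (parallel i≢j i≢k (≢-sym (punchInᵢ≢i j zero)) ij (proj₂ (dir (punchInᵢ≢i j zero)))) ij

    ends-e : ∀ {i j} → i ≢ j → φ (O j) ≡ φ (O i) △ ⁅ e j ⁆ △ ⁅ e i ⁆
    ends-e i≢j = ends i≢j (e-dir i≢j) (e-dir (≢-sym i≢j))

    e-injective : ∀ {i j} → e i ≡ e j → i ≡ j
    e-injective {i} {j} eq with i ≟ j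
    ... | yes i≡j = i≡j
    ... | no i≢j  = contradiction
      (sym (trans (ends-e i≢j)
                  (trans (cong (λ a → φ (O i) △ ⁅ e j ⁆ △ ⁅ a ⁆) eq) (△-cancel _ ⁅ e j ⁆))))
      (O-≢ i≢j)

    -- The hypercube vertex adjacent to every `O i`. Translating by it turns the given copy into the
    -- standard one.
    centre : Subset m
    centre = φ (O zero) △ ⁅ e zero ⁆

    O-centre : ∀ i → φ (O i) ≡ ⁅ e i ⁆ △ centre
    O-centre i with i ≟ zero
    ... | yes refl = sym (trans (△-comm ⁅ e zero ⁆ centre) (△-cancel (φ (O zero)) ⁅ e zero ⁆))
    ... | no i≢0   = begin
      φ (O i)                                ≡⟨ ends-e (≢-sym i≢0) ⟩
      φ (O zero) △ ⁅ e i ⁆ △ ⁅ e zero ⁆      ≡⟨ △-swap (φ (O zero)) ⁅ e i ⁆ ⁅ e zero ⁆ ⟩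
      centre △ ⁅ e i ⁆                       ≡⟨ △-comm centre ⁅ e i ⁆ ⟩
      ⁅ e i ⁆ △ centre                       ∎
      where open ≡-Reasoning

    open StandardSK e e-injective

    V-centred : ∀ s → φ (V s) △ centre ≡ ψ s
    V-centred (original i) =
      trans (cong (_△ centre) (O-centre i)) (△-cancel ⁅ e i ⁆ centre)
    V-centred (midpoint i j i<j) = begin
      φ (V (midpoint i j i<j)) △ centre       ≡⟨ cong (λ s → φ (V s) △ centre) (edge-< i<j) ⟨
      φ (M i j) △ centre                      ≡⟨ cong (_△ centre) (e-dir (midpoint-≢ i<j)) ⟩
      φ (O i) △ ⁅ e j ⁆ △ centre              ≡⟨ △-swap (φ (O i)) ⁅ e j ⁆ centre ⟩
      φ (O i) △ centre △ ⁅ e j ⁆              ≡⟨ cong (_△ ⁅ e j ⁆) (V-centred (original i)) ⟩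
      ⁅ e i ⁆ △ ⁅ e j ⁆                       ∎
      where open ≡-Reasoning

  -- For distinct coordinates this says that the set of the three is shattered, in a form that is
  -- easy to translate.
  Octants : Fin m → Fin m → Fin m → Set
  Octants a b c = ∀ p q r →
    ∃[ v ] lookup (φ v) a ≡ p × lookup (φ v) b ≡ q × lookup (φ v) c ≡ r

  at : ∀ {v S a b} → φ v ≡ S → lookup S a ≡ b → lookup (φ v) a ≡ b
  at {a = a} eq p = trans (cong (λ S → lookup S a) eq) p

  -- Gates of a convex copy in standard position, with at least four original vertices.

  module Gates
    (no-octants : ∀ {a b c} → a ≢ b → a ≢ c → b ≢ c → ¬ Octants a b c)
    {k : ℕ} (e : Fin (4 + k) → Fin m)
    (e-injective : ∀ {i j} → e i ≡ e j → i ≡ j)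
    (V : SKVertex (4 + k) → Fin N) (V-ψ : ∀ s → φ (V s) ≡ StandardSK.ψ e e-injective s)
    (H : Subset N) (V∈H : ∀ s → V s ∈ H) (H⊆V : ∀ {v} → v ∈ H → ∃[ s ] V s ≡ v)
    (convex : Convex G H) (maximal : ¬ InLargerFullSubdivision G H)
    where
    open StandardSK e e-injective

    n : ℕ
    n = 4 + k

    O : Fin n → Fin N
    O i = V (original i)

    O-self : ∀ i → lookup (φ (O i)) (e i) ≡ true
    O-self i = at (V-ψ (original i)) (lookup-⁅⁆ (e i))

    O-other : ∀ {i a} → a ≢ e i → lookup (φ (O i)) a ≡ false
    O-other a≢i = at (V-ψ (original _)) (lookup-⁅⁆-≢ a≢i)

    M : Fin n → Fin n → Fin N
    M i j = V (edge i j)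

    M-pair : ∀ {i j} → i ≢ j → φ (M i j) ≡ ⁅ e i ⁆ △ ⁅ e j ⁆
    M-pair i≢j = trans (V-ψ (edge _ _)) (ψ-edge i≢j)

    -- Such a vertex would be the middle of a path of length two between two originals. Originals
    -- are neither equal nor adjacent, so the path is shortest and convexity puts its middle into
    -- `H`, all of whose labels are nonempty.
    centre∉G : ∀ v → ¬ (∀ a → lookup (φ v) a ≡ false)
    centre∉G v empty with H⊆V (convex (V∈H (original zero)) (V∈H (original (suc zero)))
                                (~-sym (adj zero) ∷ adj (suc zero) ∷ []) shortest (there here))
      where
      φv≡⊥ : φ v ≡ Subset.⊥
      φv≡⊥ = lookup-ext λ a → trans (empty a) (sym (lookup-replicate a false))

      adj : ∀ i → v ~ O i
      adj i = flip⇒adj (trans (V-ψ (original i))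
        (trans (sym (trans (△-comm Subset.⊥ ⁅ e i ⁆) (△-identityʳ ⁅ e i ⁆)))
               (cong (_△ ⁅ e i ⁆) (sym φv≡⊥))))

      shortest : ∀ {l} → Walk G (O zero) (O (suc zero)) l → 2 ≤ l
      shortest {0} w with ψ-injective {original zero} {original (suc zero)}
        (trans (sym (V-ψ (original zero))) (trans (cong φ (walk-zero w)) (V-ψ (original (suc zero)))))
      ... | ()
      shortest {1} w with ∣△∣≡1⇒incident {original zero} {original (suc zero)}
        (trans (cong₂ (λ S T → ∣ S △ T ∣) (sym (V-ψ (original zero))) (sym (V-ψ (original (suc zero)))))
               (adj⇒∣△∣≡1 (walk-one w)))
      ... | fwd ()
      ... | bwd ()
      shortest {suc (suc l)} w = s≤s (s≤s z≤n)
    ... | s , refl with ψ-nonempty s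
    ...   | i , i∈ = contradiction (trans (sym (at (V-ψ s) i∈)) (empty (e i))) λ ()

    trace≤2 : ∀ {i j l} x → i ≢ j → i ≢ l → j ≢ l → lookup (φ x) (e i) ≡ true →
              lookup (φ x) (e j) ≡ true → lookup (φ x) (e l) ≡ true → ⊥
    trace≤2 {i} {j} {l} x i≢j i≢l j≢l xi xj xl with fresh₃ i≢j i≢l j≢l
    -- The fourth index `h` gives a vertex missing all three coordinates, `H` supplies the patterns
    -- of one or two elements, and `x` the full pattern.
    ... | h , h≢i , h≢j , h≢l = no-octants (e-≢ i≢j) (e-≢ i≢l) (e-≢ j≢l) λ
      { false false false → O h , O-other (e-≢ (≢-sym h≢i)) , O-other (e-≢ (≢-sym h≢j))
                              , O-other (e-≢ (≢-sym h≢l))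
      ; false false true  → O l , O-other (e-≢ i≢l) , O-other (e-≢ j≢l) , O-self l
      ; false true  false → O j , O-other (e-≢ i≢j) , O-self j , O-other (e-≢ (≢-sym j≢l))
      ; true  false false → O i , O-self i , O-other (e-≢ (≢-sym i≢j)) , O-other (e-≢ (≢-sym i≢l))
      ; false true  true  → M j l , at (M-pair j≢l) (pair-other (e-≢ i≢j) (e-≢ i≢l))
                                  , at (M-pair j≢l) (pair-left (e-≢ j≢l))
                                  , at (M-pair j≢l) (pair-right (e-≢ j≢l))
      ; true  false true  → M i l , at (M-pair i≢l) (pair-left (e-≢ i≢l))
                                  , at (M-pair i≢l) (pair-other (e-≢ (≢-sym i≢j)) (e-≢ j≢l))
                                  , at (M-pair i≢l) (pair-right (e-≢ i≢l))
      ; true  true  false → M i j , at (M-pair i≢j) (pair-left (e-≢ i≢j))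
                                  , at (M-pair i≢j) (pair-right (e-≢ i≢j))
                                  , at (M-pair i≢j) (pair-other (e-≢ (≢-sym i≢l)) (e-≢ (≢-sym j≢l)))
      ; true  true  true  → x , xi , xj , xl
      }

    -- Excluding an inclusion-minimal vertex with empty trace.

    module EmptyTrace (x : Fin N) (trace : ∀ i → lookup (φ x) (e i) ≡ false)
                      (minimal : ∀ w → ¬ (φ w ⊂ φ x)) where

      smaller : ∀ w b → (∀ a → lookup (φ w) a ≡ true → lookup (φ x) a ≡ true) →
                lookup (φ x) b ≡ true → lookup (φ w) b ≡ false → ⊥
      smaller w b w⊆x xb wb = minimal w
        ( (λ {a} a∈w → lookup⇒[]= a (φ x) (w⊆x a ([]=⇒lookup a∈w)))
        , b , lookup⇒[]= b (φ x) xb , lookup⇒∉ wb)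

      outside : ∀ {b i} → lookup (φ x) b ≡ true → b ≢ e i
      outside {i = i} xb refl = contradiction (trans (sym xb) (trace i)) λ ()

      -- The first step from `x` towards `O i` inserts `e i` or deletes an element of `x`;
      -- minimality rules out the deletion.
      add : ∀ i → ∃[ w ] φ w ≡ φ x △ ⁅ e i ⁆
      add i with step x (O i) (λ eq → contradiction
                   (trans (sym (trace i)) (trans (cong (λ S → lookup S (e i)) eq) (O-self i))) λ ())
      ... | w , a , w≡ , x≢O with a ≟ e i
      ...   | yes refl = w , w≡
      ...   | no a≢i   = contradiction w-a (smaller w a w⊆x x-a)
        where
        x-a : lookup (φ x) a ≡ true
        x-a = trans (¬-not x≢O) (cong not (O-other a≢i))

        w-a : lookup (φ w) a ≡ false
        w-a = at w≡ (trans (flip-same (φ x) a) (cong not x-a))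

        w⊆x : ∀ b → lookup (φ w) b ≡ true → lookup (φ x) b ≡ true
        w⊆x b wb with b ≟ a
        ... | yes refl = x-a
        ... | no b≢a   = trans (sym (at w≡ (flip-other (φ x) b≢a))) wb

      -- The other seven patterns on `e i`, `e j`, `f` occur in `H`, at `x` and at the vertices
      -- given by `add`, so `W` would complete a shattered triple.
      forbidden : ∀ {i j f} W → i ≢ j → lookup (φ x) f ≡ true → lookup (φ W) (e i) ≡ true →
                  lookup (φ W) (e j) ≡ true → lookup (φ W) f ≡ true → ⊥
      forbidden {i} {j} {f} W i≢j xf Wi Wj Wf with fresh₂ i≢j | add i | add j
      ... | h , h≢i , h≢j | xi , xi≡ | xj , xj≡ =
        no-octants (e-≢ i≢j) (≢-sym (outside xf)) (≢-sym (outside xf)) λ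
        { false false false → O h , O-other (e-≢ (≢-sym h≢i)) , O-other (e-≢ (≢-sym h≢j))
                                , O-other (outside xf)
        ; false false true  → x , trace i , trace j , xf
        ; false true  false → O j , O-other (e-≢ i≢j) , O-self j , O-other (outside xf)
        ; true  false false → O i , O-self i , O-other (e-≢ (≢-sym i≢j)) , O-other (outside xf)
        ; false true  true  → xj , at xj≡ (trans (flip-other (φ x) (e-≢ i≢j)) (trace i))
                                 , at xj≡ (trans (flip-same (φ x) (e j)) (cong not (trace j)))
                                 , at xj≡ (trans (flip-other (φ x) (outside xf)) xf)
        ; true  false true  → xi , at xi≡ (trans (flip-same (φ x) (e i)) (cong not (trace i)))
                                 , at xi≡ (trans (flip-other (φ x) (e-≢ (≢-sym i≢j))) (trace j))
                                 , at xi≡ (trans (flip-other (φ x) (outside xf)) xf)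
        ; true  true  false → M i j , at (M-pair i≢j) (pair-left (e-≢ i≢j))
                                    , at (M-pair i≢j) (pair-right (e-≢ i≢j))
                                    , at (M-pair i≢j) (pair-other (outside xf) (outside xf))
        ; true  true  true  → W , Wi , Wj , Wf
        }

      module _ {f : Fin m} (x-f : lookup (φ x) f ≡ true) where

        add-≢-O : ∀ i → φ (proj₁ (add i)) ≢ φ (O i)
        add-≢-O i eq = contradiction
          (trans (sym (at (proj₂ (add i)) (trans (flip-other (φ x) (outside x-f)) x-f)))
                 (trans (cong (λ S → lookup S f) eq) (O-other (outside x-f)))) λ ()

        differs : ∀ {i b} → lookup (φ (proj₁ (add i))) b ≢ lookup (φ (O i)) b → lookup (φ x) b ≡ true
        differs {i} {b} ne with b ≟ e i
        ... | yes refl = contradiction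
          (trans (at (proj₂ (add i)) (trans (flip-same (φ x) b) (cong not (trace i)))) (sym (O-self i))) ne
        ... | no b≢i   = trans (sym (at (proj₂ (add i)) (flip-other (φ x) b≢i)))
                               (trans (¬-not ne) (cong not (O-other b≢i)))

        -- The last vertex before `O i` on a geodesic from `x` with `e i` added, obtained as a first
        -- step in the opposite direction.
        last : ∀ i → ∃[ b ] lookup (φ x) b ≡ true × (∃[ w ] φ w ≡ ⁅ e i ⁆ △ ⁅ b ⁆)
        last i with step (O i) (proj₁ (add i)) (≢-sym (add-≢-O i))
        ... | w , b , w≡ , ne = b , differs (≢-sym ne) , w ,
          trans w≡ (cong (_△ ⁅ b ⁆) (V-ψ (original i)))

        drop : ∀ i → ∃[ a ] lookup (φ x) a ≡ true × (∃[ w ] φ w ≡ φ x △ ⁅ e i ⁆ △ ⁅ a ⁆)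
        drop i with step (proj₁ (add i)) (O i) (add-≢-O i)
        ... | w , a , w≡ , ne = a , differs ne , w , trans w≡ (cong (_△ ⁅ a ⁆) (proj₂ (add i)))

      -- If `a` and `b` differ, both `u` and `w` contain `b` and lack `a`. Where a geodesic from `u`
      -- to `w` exchanges `e j` for `e i`, a vertex with both contains `b` and is `forbidden`; one
      -- with neither is a subset of `x` without `a`, against minimality.
      drop-last-agree : ∀ {i j a b u w} → i ≢ j → lookup (φ x) a ≡ true → lookup (φ x) b ≡ true →
                        φ w ≡ φ x △ ⁅ e i ⁆ △ ⁅ a ⁆ → φ u ≡ ⁅ e j ⁆ △ ⁅ b ⁆ → a ≡ b
      drop-last-agree {i} {j} {a} {b} {u} {w} i≢j x-a x-b w≡ u≡ with a ≟ b
      ... | yes a≡b = a≡b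
      ... | no a≢b  = contradiction (cut u w
                (at u≡ (pair-left (≢-sym (outside x-b))))
                (at u≡ (pair-other (e-≢ i≢j) (≢-sym (outside x-b))))
                (trans (w-other (e-≢ (≢-sym i≢j)) (≢-sym (outside x-a))) (trace j))
                (at w≡ (trans (flip-other (φ x △ ⁅ e i ⁆) (≢-sym (outside x-a)))
                              (trans (flip-same (φ x) (e i)) (cong not (trace i))))))
              no-cut
        where
        w-other : ∀ {c} → c ≢ e i → c ≢ a → lookup (φ w) c ≡ lookup (φ x) c
        w-other c≢i c≢a = at w≡ (trans (flip-other (φ x △ ⁅ e i ⁆) c≢a) (flip-other (φ x) c≢i))

        w-a : lookup (φ w) a ≡ false
        w-a = at w≡ (trans (flip-same (φ x △ ⁅ e i ⁆) a)
                           (cong not (trans (flip-other (φ x) (outside x-a)) x-a)))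

        u-a : lookup (φ u) a ≡ false
        u-a = at u≡ (pair-other (outside x-a) a≢b)

        no-cut : ¬ Cut u w (e j) (e i)
        no-cut (y , btw , inj₁ (yj , yi)) = forbidden y i≢j x-b yi yj y-b
          where
          y-b : lookup (φ y) b ≡ true
          y-b with btw b
          ... | inj₁ y≡u = trans y≡u (at u≡ (pair-right (≢-sym (outside x-b))))
          ... | inj₂ y≡w = trans y≡w (trans (w-other (outside x-b) (≢-sym a≢b)) x-b)
        no-cut (y , btw , inj₂ (yj , yi)) = smaller y a y⊆x x-a y-a
          where
          y-a : lookup (φ y) a ≡ false
          y-a with btw a
          ... | inj₁ y≡u = trans y≡u u-a
          ... | inj₂ y≡w = trans y≡w w-a

          y⊆x : ∀ c → lookup (φ y) c ≡ true → lookup (φ x) c ≡ true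
          y⊆x c yc with c ≟ e j | c ≟ e i | c ≟ a | btw c
          ... | yes refl | _        | _        | _ = contradiction (trans (sym yc) yj) λ ()
          ... | no _     | yes refl | _        | _ = contradiction (trans (sym yc) yi) λ ()
          ... | no _     | no _     | yes refl | _ = x-a
          ... | no _     | no c≢i   | no c≢a   | inj₂ y≡w =
            trans (sym (w-other c≢i c≢a)) (trans (sym y≡w) yc)
          ... | no c≢j   | no _     | no _     | inj₁ y≡u
            with ∈pair (trans (sym (at u≡ refl)) (trans (sym y≡u) yc))
          ...   | inj₁ c≡j  = contradiction c≡j c≢j
          ...   | inj₂ refl = x-b

      -- Cutting a geodesic from `u` to `w` again yields either a `forbidden` vertex containing `b`,
      -- or a subset of `x` that lacks the second element `g`.
      last-distinct : ∀ {i j b g u w} → i ≢ j → lookup (φ x) b ≡ true →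
                      lookup (φ x) g ≡ true → g ≢ b →
                      φ u ≡ ⁅ e i ⁆ △ ⁅ b ⁆ → ¬ (φ w ≡ ⁅ e j ⁆ △ ⁅ b ⁆)
      last-distinct {i} {j} {b} {g} {u} {w} i≢j x-b x-g g≢b u≡ w≡ = no-cut (cut u w
          (at u≡ (pair-left (≢-sym (outside x-b))))
          (at u≡ (pair-other (e-≢ (≢-sym i≢j)) (≢-sym (outside x-b))))
          (at w≡ (pair-other (e-≢ i≢j) (≢-sym (outside x-b))))
          (at w≡ (pair-left (≢-sym (outside x-b)))))
        where
        no-cut : ¬ Cut u w (e i) (e j)
        no-cut (y , btw , inj₁ (yi , yj)) = forbidden y i≢j x-b yi yj y-b
          where
          y-b : lookup (φ y) b ≡ true
          y-b with btw b
          ... | inj₁ y≡u = trans y≡u (at u≡ (pair-right (≢-sym (outside x-b))))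
          ... | inj₂ y≡w = trans y≡w (at w≡ (pair-right (≢-sym (outside x-b))))
        no-cut (y , btw , inj₂ (yi , yj)) = smaller y g y⊆x x-g y-g
          where
          y-g : lookup (φ y) g ≡ false
          y-g with btw g
          ... | inj₁ y≡u = trans y≡u (at u≡ (pair-other (outside x-g) g≢b))
          ... | inj₂ y≡w = trans y≡w (at w≡ (pair-other (outside x-g) g≢b))

          y⊆x : ∀ c → lookup (φ y) c ≡ true → lookup (φ x) c ≡ true
          y⊆x c yc with c ≟ e i | c ≟ e j | c ≟ b | btw c
          ... | yes refl | _        | _        | _ = contradiction (trans (sym yc) yi) λ ()
          ... | no _     | yes refl | _        | _ = contradiction (trans (sym yc) yj) λ ()
          ... | no _     | no _     | yes refl | _ = x-b
          ... | no c≢i   | no _     | no c≢b   | inj₁ y≡u = contradiction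
            (trans (sym yc) (trans y≡u (at u≡ (pair-other c≢i c≢b)))) λ ()
          ... | no _     | no c≢j   | no c≢b   | inj₂ y≡w = contradiction
            (trans (sym yc) (trans y≡w (at w≡ (pair-other c≢j c≢b)))) λ ()

      two-elements : ∀ {f g} → lookup (φ x) f ≡ true → lookup (φ x) g ≡ true → g ≢ f → ⊥
      two-elements {f} {g} x-f x-g g≢f
        with drop x-f zero | last x-f (suc zero) | last x-f (suc (suc zero))
      ... | a , x-a , w , w≡ | b , x-b , u , u≡ | c , x-c , v , v≡
        with drop-last-agree (λ ()) x-a x-b w≡ u≡ | drop-last-agree (λ ()) x-a x-c w≡ v≡
      -- The deletion at index zero has forced the same last coordinate `a` at the two other
      -- indices; whichever of `f` and `g` differs from `a` is the second element of `x`.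
      ... | refl | refl with f ≟ a
      ...   | no f≢a   = last-distinct (λ ()) x-b x-f f≢a u≡ v≡
      ...   | yes refl = last-distinct (λ ()) x-b x-g g≢f u≡ v≡

      module _ {f : Fin m} (x≡f : φ x ≡ ⁅ f ⁆) where

        -- The vertex `x` becomes a new original of index zero, and its midpoint with `O j` is the
        -- vertex given by `add j`.
        e⁺ : Fin (suc n) → Fin m
        e⁺ zero    = f
        e⁺ (suc i) = e i

        f≢e : ∀ {i} → f ≢ e i
        f≢e = outside (at x≡f (lookup-⁅⁆ f))

        e⁺-injective : ∀ {i j} → e⁺ i ≡ e⁺ j → i ≡ j
        e⁺-injective {zero}  {zero}  eq = refl
        e⁺-injective {zero}  {suc j} eq = contradiction eq f≢e
        e⁺-injective {suc i} {zero}  eq = contradiction (sym eq) f≢e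
        e⁺-injective {suc i} {suc j} eq = cong suc (e-injective eq)

        module SK⁺ = StandardSK e⁺ e⁺-injective

        V⁺ : SKVertex (suc n) → Fin N
        V⁺ (original zero)                = x
        V⁺ (original (suc i))             = O i
        V⁺ (midpoint zero (suc j) _)      = proj₁ (add j)
        V⁺ (midpoint (suc i) (suc j) i<j) = V (midpoint i j (s<s⁻¹ i<j))

        V⁺-ψ : ∀ s → φ (V⁺ s) ≡ SK⁺.ψ s
        V⁺-ψ (original zero)                = x≡f
        V⁺-ψ (original (suc i))             = V-ψ (original i)
        V⁺-ψ (midpoint zero (suc j) _)      = trans (proj₂ (add j)) (cong (_△ ⁅ e j ⁆) x≡f)
        V⁺-ψ (midpoint (suc i) (suc j) i<j) = V-ψ (midpoint i j (s<s⁻¹ i<j))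

        open Realised e⁺ e⁺-injective V⁺ V⁺-ψ

        suc-vertex : ∀ s → ∃[ t ] ψ s ≡ SK⁺.ψ t
        suc-vertex (original i)       = original (suc i) , refl
        suc-vertex (midpoint i j i<j) = midpoint (suc i) (suc j) (s<s i<j) , refl

        -- The enlarged copy contains `H` and also `x`, which is outside `H` because labels of `H`
        -- have nonempty trace. This contradicts maximality.
        singleton : ⊥
        singleton = maximal
          (image
          , ((λ {v} v∈H → H⊆image (H⊆V v∈H)) , x , ∈image⁺ {s = original zero} x≡f , x∉H)
          , image-isometric , suc n , image≅SK)
          where
          H⊆image : ∀ {v} → (∃[ s ] V s ≡ v) → v ∈ image
          H⊆image (s , refl) =
            ∈image⁺ {s = proj₁ (suc-vertex s)} (trans (V-ψ s) (proj₂ (suc-vertex s)))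

          x∉H : x ∉ H
          x∉H x∈H with H⊆V x∈H
          ... | s , refl with ψ-nonempty s
          ...   | i , i∈ = contradiction (trans (sym (at (V-ψ s) i∈)) (trace i)) λ ()

      impossible : ⊥
      impossible with any? (λ a → lookup (φ x) a Bool.≟ true)
      ... | no empty = centre∉G x λ a → ¬-not λ xa → empty (a , xa)
      ... | yes (f , x-f) with any? (λ g → (lookup (φ x) g Bool.≟ true) ×-dec ¬? (g ≟ f))
      ...   | yes (g , x-g , g≢f) = two-elements x-f x-g g≢f
      ...   | no only-f           = singleton {f} (lookup-ext x≡f)
        where
        x≡f : ∀ a → lookup (φ x) a ≡ lookup ⁅ f ⁆ a
        x≡f a with a ≟ f
        ... | yes refl = trans x-f (sym (lookup-⁅⁆ a))
        ... | no a≢f   = trans (¬-not λ xa → only-f (a , xa , a≢f)) (sym (lookup-⁅⁆-≢ a≢f))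

    -- From traces to gates.

    trace-nonempty : ∀ x → ¬ (∀ i → lookup (φ x) (e i) ≡ false)
    trace-nonempty x = go x (⊂-wellFounded (φ x))
      where
      go : ∀ x → Acc _⊂_ (φ x) → ¬ (∀ i → lookup (φ x) (e i) ≡ false)
      -- Proper subsets of the label of `x` have empty trace too, so the induction hypothesis
      -- excludes them and `x` is minimal.
      go x (acc rec) trace = EmptyTrace.impossible x trace λ w w⊂x →
        go w (rec w⊂x) λ i → ∉⇒lookup λ i∈w → lookup⇒∉ (trace i) (proj₁ w⊂x i∈w)

    -- On the coordinates `e i` the vertex `V s` agrees with `x`; all other coordinates vanish
    -- throughout `H`. Thus `V s` lies between `x` and each vertex of `H`, and two geodesics joined
    -- at `V s` form a geodesic.
    same-trace⇒gate : ∀ x s → (∀ i → lookup (ψ s) (e i) ≡ lookup (φ x) (e i)) →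
      ∀ y → y ∈ H → ∃[ l ] Σ[ w ∈ Walk G x y l ] Shortest w × OnWalk (V s) w
    same-trace⇒gate x s same y y∈H with H⊆V y∈H
    ... | t , refl =
      _ , p ++ q ,
      (λ w → ≤-trans (≤-reflexive (between-∣△∣ (φ x) (φ (V s)) (φ (V t)) btw))
                     (proj₂ (distance x (V t)) w)) ,
      end-of-first p q
      where
      p = proj₁ (distance x (V s))
      q = proj₁ (distance (V s) (V t))

      unused : ∀ {a} → ¬ (∃[ i ] a ≡ e i) → ∀ r → lookup (φ (V r)) a ≡ false
      unused {a} ¬e r = at (V-ψ r) (¬-not λ a∈ → ¬e (ψ-used r a∈))

      btw : Between (φ x) (φ (V s)) (φ (V t))
      btw a with any? (λ i → a ≟ e i)
      ... | yes (i , refl) = inj₁ (at (V-ψ s) (same i))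
      ... | no ¬e          = inj₂ (trans (unused ¬e s) (sym (unused ¬e t)))

    ∃trace : ∀ x → ∃[ s ] (∀ i → lookup (ψ s) (e i) ≡ lookup (φ x) (e i))
    ∃trace x with any? (λ i → lookup (φ x) (e i) Bool.≟ true)
    ... | no none = contradiction (λ i → ¬-not λ xi → none (i , xi)) (trace-nonempty x)
    ... | yes (i , xi) with any? (λ j → (lookup (φ x) (e j) Bool.≟ true) ×-dec ¬? (j ≟ i))
    ...   | no only-i = original i , same
      where
      same : ∀ l → lookup ⁅ e i ⁆ (e l) ≡ lookup (φ x) (e l)
      same l with l ≟ i
      ... | yes refl = trans (lookup-⁅⁆ (e i)) (sym xi)
      ... | no l≢i   = trans (lookup-⁅⁆-≢ (e-≢ l≢i)) (sym (¬-not λ xl → only-i (l , xl , l≢i)))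
    ...   | yes (j , xj , j≢i) = edge i j , λ l → trans (cong (λ S → lookup S (e l)) (ψ-edge i≢j)) (same l)
      where
      i≢j = ≢-sym j≢i

      same : ∀ l → lookup (⁅ e i ⁆ △ ⁅ e j ⁆) (e l) ≡ lookup (φ x) (e l)
      same l with l ≟ i | l ≟ j
      ... | yes refl | _        = trans (pair-left (e-≢ i≢j)) (sym xi)
      ... | no _     | yes refl = trans (pair-right (e-≢ i≢j)) (sym xj)
      ... | no l≢i   | no l≢j   = trans (pair-other (e-≢ l≢i) (e-≢ l≢j))
        (sym (¬-not λ xl → trace≤2 x i≢j (≢-sym l≢i) (≢-sym l≢j) xi xj xl))

    gated : Gated G H
    gated x _ with ∃trace x
    ... | s , same = V s , V∈H s , same-trace⇒gate x s same

-- Translated embeddings and the VC-dimension.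

module _ {N : ℕ} {G : Graph (Fin N)} (P : PartialCube G) where
  open PartialCube P

  embedding-distance : ∀ u v → Distance G u v ∣ embed u △ embed v ∣
  embedding-distance u v =
    Equivalence.from (isometric u v _) (distance-hypercube (embed u) (embed v))

  translated-distance : ∀ c u v → Distance G u v ∣ (embed u △ c) △ (embed v △ c) ∣
  translated-distance c u v =
    subst (Distance G u v) (cong ∣_∣ (sym (△-translate (embed u) (embed v) c))) (embedding-distance u v)

  octants⇒3≤VC : ∀ {d} → VCDimension family d → ∀ {a b c} → a ≢ b → a ≢ c → b ≢ c →
                 Embedded.Octants G embed embedding-distance a b c → 3 ≤ d
  octants⇒3≤VC (_ , bound) {a} {b} {c} a≢b a≢c b≢c octants = ≤-trans 3≤∣X∣ (bound X shattered)
    where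
    X : Subset dimension
    X = ⁅ a ⁆ ∪ (⁅ b ⁆ ∪ ⁅ c ⁆)

    a∈X : a ∈ X
    a∈X = x∈p∪q⁺ (inj₁ (x∈⁅x⁆ a))

    b∈X : b ∈ X
    b∈X = x∈p∪q⁺ (inj₂ (x∈p∪q⁺ (inj₁ (x∈⁅x⁆ b))))

    c∈X : c ∈ X
    c∈X = x∈p∪q⁺ (inj₂ (x∈p∪q⁺ (inj₂ (x∈⁅x⁆ c))))

    3≤∣X∣ : 3 ≤ ∣ X ∣
    -- Distinctness allows `a`, `b` and `c` to be removed in turn, each removal lowering the
    -- cardinality.
    3≤∣X∣ = ≤-trans (s≤s (≤-trans (s≤s (≤-trans (s≤s z≤n)
              (x∈p⇒∣p-x∣<∣p∣ (x∈p∧x≢y⇒x∈p-y (x∈p∧x≢y⇒x∈p-y c∈X (≢-sym a≢c)) (≢-sym b≢c)))))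
              (x∈p⇒∣p-x∣<∣p∣ (x∈p∧x≢y⇒x∈p-y b∈X (≢-sym a≢b)))))
              (x∈p⇒∣p-x∣<∣p∣ a∈X)

    only-abc : ∀ {x} → x ≢ a → x ≢ b → x ≢ c → x ∉ X
    only-abc x≢a x≢b x≢c x∈X with x∈p∪q⁻ ⁅ a ⁆ _ x∈X
    ... | inj₁ x∈a = x≢a (x∈⁅y⁆⇒x≡y a x∈a)
    ... | inj₂ x∈bc with x∈p∪q⁻ ⁅ b ⁆ ⁅ c ⁆ x∈bc
    ...   | inj₁ x∈b = x≢b (x∈⁅y⁆⇒x≡y b x∈b)
    ...   | inj₂ x∈c = x≢c (x∈⁅y⁆⇒x≡y c x∈c)

    shattered : Shatters family X
    shattered Y = mk⇔ realise λ { (S , _ , refl) → p∩q⊆p X S }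
      where
      realise : Y ⊆ X → ∃[ S ] family S × X ∩ S ≡ Y
      realise Y⊆X with octants (lookup Y a) (lookup Y b) (lookup Y c)
      ... | v , va , vb , vc = embed v , (v , refl) , lookup-ext λ x →
        trans (lookup-zipWith _∧_ x X (embed v)) (agree x (x ≟ a) (x ≟ b) (x ≟ c))
        where
        in-X : ∀ {x} → x ∈ X → lookup (embed v) x ≡ lookup Y x →
               lookup X x ∧ lookup (embed v) x ≡ lookup Y x
        in-X x∈X eq rewrite []=⇒lookup x∈X = eq

        agree : ∀ x → Dec (x ≡ a) → Dec (x ≡ b) → Dec (x ≡ c) →
                lookup X x ∧ lookup (embed v) x ≡ lookup Y x
        agree x (yes refl) _ _ = in-X a∈X va
        agree x (no _) (yes refl) _ = in-X b∈X vb
        agree x (no _) (no _) (yes refl) = in-X c∈X vc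
        agree x (no x≢a) (no x≢b) (no x≢c)
          rewrite ∉⇒lookup (only-abc x≢a x≢b x≢c) =
          sym (∉⇒lookup (only-abc x≢a x≢b x≢c ∘ Y⊆X))

  -- Translation by `t` permutes the eight patterns, so the pattern to request is the wanted one
  -- shifted by `t`.
  octants-untranslate : ∀ t {a b c} →
    Embedded.Octants G (λ v → embed v △ t) (translated-distance t) a b c →
    Embedded.Octants G embed embedding-distance a b c
  octants-untranslate t {a} {b} {c} octants p q r
    with octants (p xor lookup t a) (q xor lookup t b) (r xor lookup t c)
  ... | v , va , vb , vc = v , untranslate p va , untranslate q vb , untranslate r vc
    where
    untranslate : ∀ {x} p → lookup (embed v △ t) x ≡ p xor lookup t x → lookup (embed v) x ≡ p
    untranslate {x} p eq =
      xor-cancelʳ (lookup t x) _ p (trans (sym (lookup-△ (embed v) t x)) eq)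

-- Gatedness, by re-centring the embedding at the given copy.

proposition23 : ∀ {N : ℕ} (G : Graph (Fin N)) → Connected G →
    (P : PartialCube G) →
    ∀ {d : ℕ} → VCDimension (PartialCube.family P) d → d ≤ 2 →
    ∀ {n : ℕ} → 4 ≤ n →
    (H : Subset N) → Induced G H ≅ SK n → Convex G H →
    ¬ InLargerFullSubdivision G H →
    Gated G H
proposition23 {N} G _ P {d} vc d≤2 {n} (s≤s (s≤s (s≤s (s≤s _)))) H H≅SK convex maximal =
  Embedded.Gates.gated G φ (translated-distance P centre)
    -- Eight patterns in the translated labelling would give eight in the original one, and hence
    -- VC-dimension at least three.
    (λ a≢b a≢c b≢c octants →
       <⇒≱ (octants⇒3≤VC P vc a≢b a≢c b≢c (octants-untranslate P centre octants)) d≤2)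
    e e-injective V V-centred H (λ s → proj₂ (from s)) H⊆V convex maximal
  where
  open PartialCube P using (embed)
  open Graph G
  open _≅_ H≅SK

  V : SKVertex n → Fin N
  V s = proj₁ (from s)

  to∘from : ∀ s → to (from s) ≡ s
  to∘from = Inverse.strictlyInverseˡ bijection

  V-adj : ∀ {s t} → SymClosure Incident s t → V s ~ V t
  V-adj {s} {t} inc = Equivalence.from (adjacency (from s) (from t))
    (subst₂ (SymClosure Incident) (sym (to∘from s)) (sym (to∘from t)) inc)

  V-adj⁻ : ∀ {s t} → V s ~ V t → SymClosure Incident s t
  V-adj⁻ {s} {t} adj = subst₂ (SymClosure Incident) (to∘from s) (to∘from t)
    (Equivalence.to (adjacency (from s) (from t)) adj)

  V-injective : ∀ {s t} → V s ≡ V t → s ≡ t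
  V-injective {s} {t} eq = trans (sym (to∘from s)) (trans (cong to (∃∈-≡ eq)) (to∘from t))

  H⊆V : ∀ {v} → v ∈ H → ∃[ s ] V s ≡ v
  H⊆V {v} v∈H = to (v , v∈H) , cong proj₁ (Inverse.strictlyInverseʳ bijection (v , v∈H))

  -- The directions are computed in the original embedding; the gates are then found in its
  -- translate `φ`, where `H` is in standard position.
  open Embedded.Directions G embed (embedding-distance P) V V-adj V-adj⁻ V-injective

  φ : Fin N → Subset (PartialCube.dimension P)
  φ v = embed v △ centre
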